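{- Let $G$ be a cubic claw-free graph. Then $\gamma(G)\leq \gamma_e(G)$.
   Context: All graphs are finite, simple, and undirected. A graph is cubic if it is $3$-regular, that is, every vertex has exactly $3$ neighbors. A graph is claw-free if it has no induced subgraph isomorphic to the claw $K_{1,3}$, that is, no vertex has three pairwise non-adjacent neighbors. A set $D\subseteq V(G)$ is a dominating set in $G$ if every vertex in $V(G)\setminus D$ has a neighbor in $D$; the domination number $\gamma(G)$ is the minimum cardinality of a dominating set in $G$. A matching in $G$ is a set of pairwise disjoint edges of $G$; it is maximal if it is maximal with respect to inclusion among matchings in $G$ (equivalently, the set of vertices not incident with any edge of the matching is independent). The edge domination number $\gamma_e(G)$ is the minimum size (number of edges) of a maximal matching in $G$. -}

module Defs where

open import Data.Fin.Base using (Fin; zero; _<_)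
open import Data.Fin.Properties using (_≟_; _<?_; all?; any?)
open import Data.Fin.Subset using (Subset; _∈_; _∉_; _⊂_; ∣_∣; ∁; ⊤; ⊥)
open import Data.Fin.Subset.Properties
  using (_∈?_; _⊂?_; ∈⊤; ∉⊥; anySubset?; p⊂q⇒∣p∣<∣q∣; p⊂q⇒∁p⊃∁q)
open import Data.List.Base using (List; length; lookup; filter; allFin; cartesianProduct)
open import Data.Nat.Base as ℕ using (ℕ; _≤_)
import Data.Nat.Properties as ℕ
open import Data.Nat.Induction using (<-wellFounded)
open import Data.Product.Base using (∃; ∃-syntax; _×_; _,_; proj₁; proj₂; uncurry; swap)
open import Data.Sum.Base using (_⊎_; inj₁; inj₂)
import Data.Sum.Base as Sum
open import Data.Vec.Base using (tabulate)
open import Function.Base using (_∘_)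
open import Function.Bundles using (_⇔_)
open import Function.Definitions using (Injective)
open import Induction.WellFounded using (Acc; acc)
open import Level using (0ℓ)
open import Relation.Binary.Core using (Rel)
open import Relation.Binary.Definitions using (Decidable; Symmetric; Irreflexive)
open import Relation.Binary.PropositionalEquality using (_≡_; _≢_; refl)
open import Relation.Nullary using (¬_; Dec; yes; no; does; contradiction)
open import Relation.Nullary.Decidable using (_×-dec_; _⊎-dec_; _→-dec_; ¬?)
import Relation.Unary as U

record Graph (n : ℕ) : Set₁ where
  field
    Adj    : Rel (Fin n) 0ℓ
    adj?   : Decidable Adj
    symm   : Symmetric Adj
    irrefl : Irreflexive _≡_ Adj

K₁,₃ : Graph 4
K₁,₃ = record
  { Adj    = λ i j → (i ≡ zero × j ≢ zero) ⊎ (i ≢ zero × j ≡ zero)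
  ; adj?   = λ i j → ((i ≟ zero) ×-dec ¬? (j ≟ zero)) ⊎-dec (¬? (i ≟ zero) ×-dec (j ≟ zero))
  ; symm   = Sum.swap ∘ Sum.map swap swap
  ; irrefl = λ { refl (inj₁ (i≡0 , i≢0)) → i≢0 i≡0 ; refl (inj₂ (i≢0 , i≡0)) → i≢0 i≡0 }
  }

-- Some induced subgraph of G is isomorphic to H: H is carried injectively to
-- G, both preserving and reflecting adjacency.
HasInduced : ∀ {k n} → Graph k → Graph n → Set
HasInduced {k} {n} H G = ∃[ f ]
  Injective _≡_ _≡_ f × (∀ i j → Graph.Adj H i j ⇔ Graph.Adj G (f i) (f j))

ClawFree : ∀ {n} → Graph n → Set
ClawFree G = ¬ HasInduced K₁,₃ G

-- Among the subsets satisfying a decidable, inhabited predicate, one on which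
-- f is least.
minimiser : ∀ {m} {P : U.Pred (Subset m) 0ℓ} → U.Decidable P → (f : Subset m → ℕ) →
            ∃ P → ∃[ p ] P p × (∀ q → P q → f p ≤ f q)
minimiser {m} {P} P? f (p , Pp) = go p Pp (<-wellFounded (f p))
  where
  go : ∀ p → P p → Acc ℕ._<_ (f p) → ∃[ p ] P p × (∀ q → P q → f p ≤ f q)
  go p Pp (acc rec) with anySubset? (λ q → P? q ×-dec (f q ℕ.<? f p))
  ... | yes (q , Pq , fq<fp) = go q Pq (rec fq<fp)
  ... | no ∄q                = p , Pp , λ q Pq → ℕ.≮⇒≥ (λ fq<fp → ∄q (q , Pq , fq<fp))

module _ {n : ℕ} (G : Graph n) where
  open Graph G

  neighbours : Fin n → Subset n
  neighbours v = tabulate (λ u → does (adj? v u))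

  Cubic : Set
  Cubic = ∀ v → ∣ neighbours v ∣ ≡ 3

  Dominating : Subset n → Set
  Dominating D = ∀ v → v ∉ D → ∃[ u ] u ∈ D × Adj v u

  dominating? : U.Decidable Dominating
  dominating? D = all? λ v → ¬? (v ∈? D) →-dec any? λ u → (u ∈? D) ×-dec adj? v u

  minimumDominatingSet : ∃[ D ] Dominating D × (∀ D′ → Dominating D′ → ∣ D ∣ ≤ ∣ D′ ∣)
  minimumDominatingSet =
    minimiser dominating? ∣_∣ (⊤ , λ v v∉⊤ → contradiction ∈⊤ v∉⊤)

  γ : ℕ
  γ = ∣ proj₁ minimumDominatingSet ∣

  -- Every edge is listed exactly once, as (u , v) with u < v, so that sets of
  -- edges are subsets of the positions in this list.
  edges : List (Fin n × Fin n)
  edges = filter (uncurry λ u v → (u <? v) ×-dec adj? u v)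
                 (cartesianProduct (allFin n) (allFin n))

  Edge : Set
  Edge = Fin (length edges)

  EdgeSet : Set
  EdgeSet = Subset (length edges)

  Incident : Fin n → Edge → Set
  Incident v e = v ≡ proj₁ (lookup edges e) ⊎ v ≡ proj₂ (lookup edges e)

  incident? : Decidable Incident
  incident? v e = (v ≟ proj₁ (lookup edges e)) ⊎-dec (v ≟ proj₂ (lookup edges e))

  Disjoint : Rel Edge 0ℓ
  Disjoint e f = ¬ (∃[ v ] Incident v e × Incident v f)

  disjoint? : Decidable Disjoint
  disjoint? e f = ¬? (any? λ v → incident? v e ×-dec incident? v f)

  Matching : EdgeSet → Set
  Matching M = ∀ e f → e ∈ M → f ∈ M → e ≢ f → Disjoint e f

  matching? : U.Decidable Matching
  matching? M = all? λ e → all? λ f →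
    (e ∈? M) →-dec ((f ∈? M) →-dec (¬? (e ≟ f) →-dec disjoint? e f))

  MaximalMatching : EdgeSet → Set
  MaximalMatching M = Matching M × ¬ (∃[ M′ ] Matching M′ × M ⊂ M′)

  maximalMatching? : U.Decidable MaximalMatching
  maximalMatching? M =
    matching? M ×-dec ¬? (anySubset? λ M′ → matching? M′ ×-dec (M ⊂? M′))

  maximalMatching : ∃ MaximalMatching
  maximalMatching
    with minimiser matching? (∣_∣ ∘ ∁) (⊥ , λ e f e∈⊥ → contradiction e∈⊥ ∉⊥)
  ... | M , matching , least = M , matching , λ (M′ , matching′ , M⊂M′) →
    ℕ.<⇒≱ (p⊂q⇒∣p∣<∣q∣ (p⊂q⇒∁p⊃∁q M⊂M′)) (least M′ matching′)

  minimumMaximalMatching :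
    ∃[ M ] MaximalMatching M × (∀ M′ → MaximalMatching M′ → ∣ M ∣ ≤ ∣ M′ ∣)
  minimumMaximalMatching = minimiser maximalMatching? ∣_∣ maximalMatching

  γₑ : ℕ
  γₑ = ∣ proj₁ minimumMaximalMatching ∣

{-# OPTIONS --safe #-}
module Submission where

-- Choose one endpoint of every edge of a minimum maximal matching M. Matched
-- vertices are then dominated, and so is an unmatched vertex with two
-- neighbours joined by M. Any other unmatched vertex u lies in a triangle u x y,
-- as G is claw-free, and x and y are matched; it suffices to choose x or y.
-- The pairs {x , y} arising in this way form a matching too, for x has no
-- neighbours besides u, y and its mate. Hence the cycles alternating between M
-- and these pairs are even, and every second vertex along the alternating
-- paths and cycles can be chosen.

open import Defs
open import Data.Empty using (⊥)
open import Data.Fin.Base using (Fin; zero; suc; _<_)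
open import Data.Fin.Properties using (_≟_; _<?_; any?; <-cmp; sequence)
open import Data.Fin.Subset as Subset
  using (Subset; _∈_; _∉_; _⊆_; _⊂_; _∪_; _-_; ⁅_⁆; ∣_∣; inside; outside)
open import Data.Fin.Subset.Properties
  using (_∈?_; x∈⁅x⁆; x∈⁅y⁆⇒x≡y; x∈p∪q⁺; x∈p∪q⁻; x∈p∧x≢y⇒x∈p-y; x∈p⇒∣p-x∣<∣p∣; ∣⊥∣≡0; ∪-identityˡ)
open import Data.List.Base using (List; []; _∷_; lookup; allFin; cartesianProduct)
import Data.List.Membership.Propositional as List
open import Data.List.Membership.Propositional.Properties
  using (∈-allFin; ∈-cartesianProduct⁺; ∈-filter⁺; ∈-filter⁻; ∈-lookup)
open import Data.List.Relation.Unary.Any using (here; there; index)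
open import Data.List.Relation.Unary.Any.Properties using (lookup-index)
open import Data.Nat.Base using (ℕ; zero; suc; _≤_; z≤n; s≤s)
import Data.Nat.Properties as ℕ
open import Data.Product.Base using (∃-syntax; _×_; _,_; proj₁; proj₂; uncurry)
open import Data.Sum.Base using (_⊎_; inj₁; inj₂; [_,_]′)
import Data.Sum.Base as Sum
open import Data.Vec.Base as Vec using ([]; _∷_; here; there)
open import Data.Vec.Properties using ([]=⇒lookup; lookup⇒[]=; lookup∘tabulate)
open import Effect.Monad using (RawMonad)
open import Function.Base using (_∘_)
open import Function.Bundles using (mk⇔)
open import Function.Definitions using (Injective)
open import Level using (0ℓ)
open import Relation.Binary.Core using (Rel)
open import Relation.Binary.Definitions using (Decidable; Symmetric; tri<; tri≈; tri>)
open import Relation.Binary.PropositionalEquality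
  using (_≡_; _≢_; refl; sym; trans; cong; subst; ≢-sym)
open import Relation.Nullary using (¬_; Dec; yes; no; contradiction)
open import Relation.Nullary.Decidable
  using (_×-dec_; ¬?; dec-true; decidable-stable; ¬¬-excluded-middle)
open import Relation.Nullary.Negation using (¬¬-Monad)
open import Relation.Unary using (Pred)

-- Alternating paths of two partial matchings `P` and `S`.

module _
  {A : Set} {P S : Rel A 0ℓ}
  (P-sym : Symmetric P) (P-irrefl : ∀ {x} → ¬ P x x)
  (P-functional : ∀ {x y z} → P x y → P x z → y ≡ z)
  (S-sym : Symmetric S) (S-irrefl : ∀ {x} → ¬ S x x)
  (S-functional : ∀ {x y z} → S x y → S x z → y ≡ z)
  where

  -- A walk made of such steps records every second vertex of an alternating path. These are the
  -- vertices to be chosen together; the ones skipped are their `P`-partners.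
  Step : Rel A 0ℓ
  Step x z = ∃[ y ] P x y × S y z

  Walk : ℕ → Rel A 0ℓ
  Walk zero    x z = x ≡ z
  Walk (suc k) x z = ∃[ y ] Step x y × Walk k y z

  Step-functional : ∀ {x y z} → Step x y → Step x z → y ≡ z
  Step-functional (_ , p , s) (_ , p′ , s′) with refl ← P-functional p p′ =
    S-functional s s′

  snoc : ∀ k {x y z} → Walk k x y → Step y z → Walk (suc k) x z
  snoc zero    refl          y→z = _ , y→z , refl
  snoc (suc k) (_ , x→w , w) y→z = _ , x→w , snoc k w y→z

  unsnoc : ∀ k {x z} → Walk (suc k) x z → ∃[ y ] Walk k x y × Step y z
  unsnoc zero    (_ , x→y , refl) = _ , refl , x→y
  unsnoc (suc k) (_ , x→w , w) with y , w′ , y→z ← unsnoc k w = y , (_ , x→w , w′) , y→z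

  -- Steps are deterministic, so of two walks with a common start the longer one continues the
  -- shorter.
  compare-walks : ∀ i j {x y z} → Walk i x y → Walk j x z →
                  (∃[ k ] Walk k y z) ⊎ (∃[ k ] Walk k z y)
  compare-walks zero    j       refl          w             = inj₁ (j , w)
  compare-walks (suc i) zero    w             refl          = inj₂ (suc i , w)
  compare-walks (suc i) (suc j) (_ , x→u , v) (_ , x→u′ , w)
    with refl ← Step-functional x→u x→u′ = compare-walks i j v w

  -- A P-edge (or S-edge) joining the ends of an alternating path would be its
  -- first and last edge at once; peeling it off from both sides, the path
  -- eventually collapses to a loop.
  mutual
    ¬P-between-ends : ∀ k {x z} → Walk k x z → ¬ P x z
    ¬P-between-ends zero    refl                  p = P-irrefl p
    ¬P-between-ends (suc k) (_ , (_ , p′ , s) , w) p with refl ← P-functional p p′ =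
      ¬S-between-ends k w s

    ¬S-between-ends : ∀ k {x z} → Walk k x z → ¬ S z x
    ¬S-between-ends zero    refl s = S-irrefl s
    ¬S-between-ends (suc k) w    s with _ , w′ , (_ , p , s′) ← unsnoc k w
      with refl ← S-functional s (S-sym s′) = ¬P-between-ends k w′ (P-sym p)

  Reachable : A → Pred A 0ℓ
  Reachable x z = ∃[ k ] Walk k x z

  -- Closure takes care of vertices left out of `D`: if the `P`-partner of x lies in `D`, a step
  -- from it through x puts the `S`-partner of x into `D`, and the `S`-pair at x is met.
  Independent Closed : Pred A 0ℓ → Set
  Independent D = ∀ {x y} → D x → D y → ¬ P x y
  Closed      D = ∀ {x y} → D x → Step x y → D y

  -- One of the two vertices is reachable from the other, and `P` never joins the ends of a walk.
  Reachable-independent : ∀ x → Independent (Reachable x)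
  Reachable-independent x (i , v) (j , w) p with compare-walks i j v w
  ... | inj₁ (k , u) = ¬P-between-ends k u p
  ... | inj₂ (k , u) = ¬P-between-ends k u (P-sym p)

  -- Read backwards, the walk from x to z becomes a walk from the `P`-partner of z to that of x, and
  -- `D` is closed under its steps.
  pull-back : ∀ {D} → Closed D → ∀ k {x z w} → Walk k x z → P z w → D w →
              ∃[ p ] P x p × D p
  pull-back closed zero    refl                   p Dw = _ , p , Dw
  pull-back closed (suc k) (_ , (y , x~y , s) , v) p Dw
    with q , p′ , Dq ← pull-back closed k v p Dw =
    y , x~y , closed Dq (_ , P-sym p′ , S-sym s)

  Meets : Pred A 0ℓ → A → Set
  Meets D x = ∀ {y} → S x y → D x ⊎ D y

  -- Induction on the list: if neither x nor its `P`-partner is in `D`, everything reachable from x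
  -- is added. The double negation is there because membership in `D` involves walks of unbounded
  -- length and is not decided.
  ¬¬-transversal : (xs : List A) →
    ¬ ¬ (∃[ D ] Independent D × Closed D × (∀ {x} → x List.∈ xs → Meets D x))
  ¬¬-transversal []       k = k ((λ _ → ⊥) , (λ ()) , (λ ()) , λ ())
  ¬¬-transversal (x ∷ xs) k = ¬¬-transversal xs λ (D , independent , closed , meets) →
    ¬¬-excluded-middle {A = D x ⊎ ∃[ p ] P x p × D p} λ where
      (yes (inj₁ Dx)) → k (D , independent , closed , λ where
        (here refl) _ → inj₁ Dx
        (there x∈)  s → meets x∈ s)
      (yes (inj₂ (p , x~p , Dp))) → k (D , independent , closed , λ where
        (here refl) s → inj₂ (closed Dp (x , P-sym x~p , s))
        (there x∈)  s → meets x∈ s)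
      (no ¬D) →
        -- A `P`-edge between an old and a new member would, pulled back along the walk, put the
        -- `P`-partner of x into `D`.
        let ¬joined : ∀ {z w} → Reachable x z → D w → ¬ P z w
            ¬joined (i , v) Dw p = ¬D (inj₂ (pull-back closed i v p Dw))
        in k ( (λ z → D z ⊎ Reachable x z)
             , (λ where
                 (inj₁ d) (inj₁ d′) → independent d d′
                 (inj₁ d) (inj₂ r)  → ¬joined r d ∘ P-sym
                 (inj₂ r) (inj₁ d)  → ¬joined r d
                 (inj₂ r) (inj₂ r′) → Reachable-independent x r r′)
             , (λ where
                 (inj₁ d)       y→z → inj₁ (closed d y→z)
                 (inj₂ (i , v)) y→z → inj₂ (suc i , snoc i v y→z))
             , λ where
                 (here refl) _ → inj₁ (inj₂ (0 , refl))
                 (there x∈)  s → Sum.map inj₁ inj₁ (meets x∈ s))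

-- Double negation commutes with finite products, so excluded middle may be assumed at all points of
-- `Fin n` at once.
¬¬-decidable : ∀ {n} (D : Pred (Fin n) 0ℓ) → ¬ ¬ (∀ x → Dec (D x))
¬¬-decidable D = sequence (RawMonad.rawApplicative ¬¬-Monad) (λ _ → ¬¬-excluded-middle)

-- Counting in finite subsets.

∣⁅x⁆∪p∣≤1+∣p∣ : ∀ {n} (x : Fin n) (p : Subset n) → ∣ ⁅ x ⁆ ∪ p ∣ ≤ suc ∣ p ∣
∣⁅x⁆∪p∣≤1+∣p∣ zero    (outside ∷ p) rewrite ∪-identityˡ p = ℕ.≤-refl
∣⁅x⁆∪p∣≤1+∣p∣ zero    (inside  ∷ p) rewrite ∪-identityˡ p = ℕ.n≤1+n _
∣⁅x⁆∪p∣≤1+∣p∣ (suc x) (outside ∷ p) = ∣⁅x⁆∪p∣≤1+∣p∣ x p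
∣⁅x⁆∪p∣≤1+∣p∣ (suc x) (inside  ∷ p) = s≤s (∣⁅x⁆∪p∣≤1+∣p∣ x p)

-- The sizes are only bounded, since `f` may send several members to the same point.
image : ∀ {m n} (f : Fin m → Fin n) (p : Subset m) →
        ∃[ q ] ∣ q ∣ ≤ ∣ p ∣ × (∀ {x} → x ∈ p → f x ∈ q)
image {n = n} f [] = Subset.⊥ , ℕ.≤-reflexive (∣⊥∣≡0 n) , λ ()
image f (outside ∷ p) with q , ∣q∣≤∣p∣ , f∈q ← image (f ∘ suc) p =
  q , ∣q∣≤∣p∣ , λ { (there x∈p) → f∈q x∈p }
image f (inside ∷ p) with q , ∣q∣≤∣p∣ , f∈q ← image (f ∘ suc) p =
  ⁅ f zero ⁆ ∪ q , ℕ.≤-trans (∣⁅x⁆∪p∣≤1+∣p∣ (f zero) q) (s≤s ∣q∣≤∣p∣) , λ where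
    here        → x∈p∪q⁺ (inj₁ (x∈⁅x⁆ _))
    (there x∈p) → x∈p∪q⁺ (inj₂ (f∈q x∈p))

pick : ∀ {n k} (p : Subset n) → ∣ p ∣ ≡ suc k →
       ∃[ x ] ∃[ q ] x ∈ p × x ∉ q × q ⊆ p × ∣ q ∣ ≡ k
pick (inside  ∷ p) eq =
  zero , outside ∷ p , here , (λ ()) , (λ { (there y∈) → there y∈ }) , ℕ.suc-injective eq
pick (outside ∷ p) eq with x , q , x∈p , x∉q , q⊆p , ∣q∣≡k ← pick p eq =
  suc x , outside ∷ q , there x∈p , (λ { (there x∈q) → x∉q x∈q }) ,
  (λ { (there y∈) → there (q⊆p y∈) }) , ∣q∣≡k

∣p∣≡3⇒three-members : ∀ {n} {p : Subset n} → ∣ p ∣ ≡ 3 →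
  ∃[ x ] ∃[ y ] ∃[ z ] (x ∈ p × y ∈ p × z ∈ p) × (x ≢ y × x ≢ z × y ≢ z)
∣p∣≡3⇒three-members {p = p} eq
  with x , q , x∈p , x∉q , q⊆p , ∣q∣≡2 ← pick p eq
  with y , r , y∈q , y∉r , r⊆q , ∣r∣≡1 ← pick q ∣q∣≡2
  with z , _ , z∈r , _ ← pick r ∣r∣≡1 =
  x , y , z , (x∈p , q⊆p y∈q , q⊆p (r⊆q z∈r)) ,
  ((λ { refl → x∉q y∈q }) , (λ { refl → x∉q (r⊆q z∈r) }) , λ { refl → y∉r z∈r })

-- Four distinct members, removed one after another, would each lower the size.
∣p∣≡3⇒no-fourth : ∀ {n} {p : Subset n} {x y z w} → ∣ p ∣ ≡ 3 →
  x ∈ p → y ∈ p → z ∈ p → x ≢ y → x ≢ z → y ≢ z → w ∈ p → w ≡ x ⊎ w ≡ y ⊎ w ≡ z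
∣p∣≡3⇒no-fourth {p = p} {x} {y} {z} {w} eq x∈ y∈ z∈ x≢y x≢z y≢z w∈
  with w ≟ x | w ≟ y | w ≟ z
... | yes w≡x | _       | _       = inj₁ w≡x
... | no _    | yes w≡y | _       = inj₂ (inj₁ w≡y)
... | no _    | no _    | yes w≡z = inj₂ (inj₂ w≡z)
... | no w≢x  | no w≢y  | no w≢z  = contradiction 4≤∣p∣ (ℕ.<⇒≱ (s≤s (ℕ.≤-reflexive eq)))
  where
  z∈′ : z ∈ p - x - y
  z∈′ = x∈p∧x≢y⇒x∈p-y (x∈p∧x≢y⇒x∈p-y z∈ (≢-sym x≢z)) (≢-sym y≢z)
  w∈′ : w ∈ p - x - y - z
  w∈′ = x∈p∧x≢y⇒x∈p-y (x∈p∧x≢y⇒x∈p-y (x∈p∧x≢y⇒x∈p-y w∈ w≢x) w≢y) w≢z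
  4≤∣p∣ : 4 ≤ ∣ p ∣
  4≤∣p∣ = ℕ.≤-<-trans (ℕ.≤-<-trans (ℕ.≤-<-trans (ℕ.≤-<-trans z≤n
            (x∈p⇒∣p-x∣<∣p∣ w∈′)) (x∈p⇒∣p-x∣<∣p∣ z∈′))
            (x∈p⇒∣p-x∣<∣p∣ (x∈p∧x≢y⇒x∈p-y y∈ (≢-sym x≢y)))) (x∈p⇒∣p-x∣<∣p∣ x∈)

-- Neighbourhoods in cubic claw-free graphs.

module _ {n : ℕ} (G : Graph n) where
  open Graph G

  Adj⇒∈neighbours : ∀ {v u} → Adj v u → u ∈ neighbours G v
  Adj⇒∈neighbours {v} {u} v~u = lookup⇒[]= u _
    (trans (lookup∘tabulate _ u) (dec-true (adj? v u) v~u))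

  ∈neighbours⇒Adj : ∀ {v u} → u ∈ neighbours G v → Adj v u
  ∈neighbours⇒Adj {v} {u} u∈ with adj? v u | trans (sym (lookup∘tabulate _ u)) ([]=⇒lookup u∈)
  ... | yes v~u | _ = v~u

  adj⇒≢ : ∀ {x y} → Adj x y → x ≢ y
  adj⇒≢ x~y x≡y = irrefl x≡y x~y

  induced-claw : ∀ {u a b c} → Adj u a → Adj u b → Adj u c → a ≢ b → a ≢ c → b ≢ c →
                 ¬ Adj a b → ¬ Adj a c → ¬ Adj b c → HasInduced K₁,₃ G
  induced-claw {u} {a} {b} {c} ua ub uc a≢b a≢c b≢c ¬ab ¬ac ¬bc =
    f , injective , λ i j → mk⇔ (to i j) (from i j)
    where
    f : Fin 4 → Fin n
    f = Vec.lookup (u ∷ a ∷ b ∷ c ∷ [])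

    to : ∀ i j → Graph.Adj K₁,₃ i j → Adj (f i) (f j)
    to zero zero (inj₁ (_ , ≢)) = contradiction refl ≢
    to zero zero (inj₂ (≢ , _)) = contradiction refl ≢
    to zero (suc zero) _ = ua
    to zero (suc (suc zero)) _ = ub
    to zero (suc (suc (suc zero))) _ = uc
    to (suc zero) zero _ = symm ua
    to (suc (suc zero)) zero _ = symm ub
    to (suc (suc (suc zero))) zero _ = symm uc
    to (suc _) (suc _) (inj₁ (() , _))
    to (suc _) (suc _) (inj₂ (_ , ()))

    ¬leaves : ∀ i j → ¬ Adj (f (suc i)) (f (suc j))
    ¬leaves zero zero = irrefl refl
    ¬leaves zero (suc zero) = ¬ab
    ¬leaves zero (suc (suc zero)) = ¬ac
    ¬leaves (suc zero) zero = ¬ab ∘ symm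
    ¬leaves (suc zero) (suc zero) = irrefl refl
    ¬leaves (suc zero) (suc (suc zero)) = ¬bc
    ¬leaves (suc (suc zero)) zero = ¬ac ∘ symm
    ¬leaves (suc (suc zero)) (suc zero) = ¬bc ∘ symm
    ¬leaves (suc (suc zero)) (suc (suc zero)) = irrefl refl

    from : ∀ i j → Adj (f i) (f j) → Graph.Adj K₁,₃ i j
    from zero    zero    p = contradiction p (irrefl refl)
    from zero    (suc j) p = inj₁ (refl , λ ())
    from (suc i) zero    p = inj₂ ((λ ()) , refl)
    from (suc i) (suc j) p = contradiction p (¬leaves i j)

    ¬centre≡leaf : ∀ i → f zero ≢ f (suc i)
    ¬centre≡leaf i = adj⇒≢ (to zero (suc i) (inj₁ (refl , λ ())))

    injective : Injective _≡_ _≡_ f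
    injective {zero}  {zero}  _  = refl
    injective {zero}  {suc j} eq = contradiction eq (¬centre≡leaf j)
    injective {suc i} {zero}  eq = contradiction (sym eq) (¬centre≡leaf i)
    injective {suc zero} {suc zero} _ = refl
    injective {suc zero} {suc (suc zero)} eq = contradiction eq a≢b
    injective {suc zero} {suc (suc (suc zero))} eq = contradiction eq a≢c
    injective {suc (suc zero)} {suc zero} eq = contradiction (sym eq) a≢b
    injective {suc (suc zero)} {suc (suc zero)} _ = refl
    injective {suc (suc zero)} {suc (suc (suc zero))} eq = contradiction eq b≢c
    injective {suc (suc (suc zero))} {suc zero} eq = contradiction (sym eq) a≢c
    injective {suc (suc (suc zero))} {suc (suc zero)} eq = contradiction (sym eq) b≢c
    injective {suc (suc (suc zero))} {suc (suc (suc zero))} _ = refl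

  module _ (cubic : Cubic G) where

    neighbour-cases : ∀ {v a b c d} → Adj v a → Adj v b → Adj v c →
                      a ≢ b → a ≢ c → b ≢ c → Adj v d → d ≡ a ⊎ d ≡ b ⊎ d ≡ c
    neighbour-cases {v} va vb vc a≢b a≢c b≢c vd = ∣p∣≡3⇒no-fourth (cubic v)
      (Adj⇒∈neighbours va) (Adj⇒∈neighbours vb) (Adj⇒∈neighbours vc) a≢b a≢c b≢c
      (Adj⇒∈neighbours vd)

    -- Otherwise u and its three neighbours would induce a claw.
    adjacent-neighbours : ClawFree G → ∀ u → ∃[ x ] ∃[ y ] Adj u x × Adj u y × Adj x y
    adjacent-neighbours claw-free u
      with x , y , z , (x∈ , y∈ , z∈) , (x≢y , x≢z , y≢z) ← ∣p∣≡3⇒three-members (cubic u)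
      with adj? x y | adj? x z | adj? y z
    ... | yes xy | _      | _      = x , y , ∈neighbours⇒Adj x∈ , ∈neighbours⇒Adj y∈ , xy
    ... | no _   | yes xz | _      = x , z , ∈neighbours⇒Adj x∈ , ∈neighbours⇒Adj z∈ , xz
    ... | no _   | no _   | yes yz = y , z , ∈neighbours⇒Adj y∈ , ∈neighbours⇒Adj z∈ , yz
    ... | no ¬xy | no ¬xz | no ¬yz = contradiction
      (induced-claw (∈neighbours⇒Adj x∈) (∈neighbours⇒Adj y∈) (∈neighbours⇒Adj z∈)
        x≢y x≢z y≢z ¬xy ¬xz ¬yz) claw-free

  -- Edges and their ends.

  source target : Edge G → Fin n
  source e = proj₁ (lookup (edges G) e)
  target e = proj₂ (lookup (edges G) e)

  private
    isEdge? : ∀ (e : Fin n × Fin n) → Dec (proj₁ e < proj₂ e × Adj (proj₁ e) (proj₂ e))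
    isEdge? = uncurry λ u v → (u <? v) ×-dec adj? u v

  source~target : ∀ e → Adj (source e) (target e)
  source~target e =
    proj₂ (proj₂ (∈-filter⁻ isEdge? {xs = cartesianProduct (allFin n) (allFin n)}
      (∈-lookup {xs = edges G} e)))

  ends-adjacent : ∀ {x y e} → Incident G x e → Incident G y e → x ≢ y → Adj x y
  ends-adjacent         (inj₁ refl) (inj₁ refl) x≢y = contradiction refl x≢y
  ends-adjacent {e = e} (inj₁ refl) (inj₂ refl) x≢y = source~target e
  ends-adjacent {e = e} (inj₂ refl) (inj₁ refl) x≢y = symm (source~target e)
  ends-adjacent         (inj₂ refl) (inj₂ refl) x≢y = contradiction refl x≢y

  other-end : ∀ {x y z e} → Incident G x e → Incident G y e → Incident G z e →
              x ≢ y → x ≢ z → y ≡ z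
  other-end (inj₁ refl) (inj₁ refl) _           x≢y _   = contradiction refl x≢y
  other-end (inj₁ refl) (inj₂ refl) (inj₁ refl) _   x≢z = contradiction refl x≢z
  other-end (inj₁ refl) (inj₂ refl) (inj₂ refl) _   _   = refl
  other-end (inj₂ refl) (inj₂ refl) _           x≢y _   = contradiction refl x≢y
  other-end (inj₂ refl) (inj₁ refl) (inj₂ refl) _   x≢z = contradiction refl x≢z
  other-end (inj₂ refl) (inj₁ refl) (inj₁ refl) _   _   = refl

  -- Edges are listed with the smaller end first, hence the comparison of x and y. The last
  -- component serves to show such an edge disjoint from others.
  edge : ∀ {x y} → Adj x y →
         ∃[ e ] Incident G x e × Incident G y e × (∀ {z} → Incident G z e → z ≡ x ⊎ z ≡ y)
  edge {x} {y} x~y with <-cmp x y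
  ... | tri≈ _ x≡y _ = contradiction x~y (irrefl x≡y)
  ... | tri< x<y _ _ = index xy∈ , inj₁ (cong proj₁ eq) , inj₂ (cong proj₂ eq) ,
    Sum.map (λ p → trans p (sym (cong proj₁ eq))) (λ p → trans p (sym (cong proj₂ eq)))
    where
    xy∈ : (x , y) List.∈ edges G
    xy∈ = ∈-filter⁺ isEdge? (∈-cartesianProduct⁺ (∈-allFin x) (∈-allFin y)) (x<y , x~y)
    eq = lookup-index xy∈
  ... | tri> _ _ y<x = index yx∈ , inj₂ (cong proj₂ eq) , inj₁ (cong proj₁ eq) ,
    Sum.swap ∘ Sum.map (λ p → trans p (sym (cong proj₁ eq))) (λ p → trans p (sym (cong proj₂ eq)))
    where
    yx∈ : (y , x) List.∈ edges G
    yx∈ = ∈-filter⁺ isEdge? (∈-cartesianProduct⁺ (∈-allFin y) (∈-allFin x)) (y<x , symm x~y)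
    eq = lookup-index yx∈

  -- Matched vertices and maximality.

  module _ {M : EdgeSet G} (matching : Matching G M) where

    -- The clause `x ≢ y` keeps a matched vertex from being its own mate.
    Mates : Rel (Fin n) 0ℓ
    Mates x y = ∃[ e ] e ∈ M × Incident G x e × Incident G y e × x ≢ y

    mates? : Decidable Mates
    mates? x y = any? λ e →
      (e ∈? M) ×-dec (incident? G x e ×-dec (incident? G y e ×-dec ¬? (x ≟ y)))

    mates-sym : Symmetric Mates
    mates-sym (e , e∈M , x∈e , y∈e , x≢y) = e , e∈M , y∈e , x∈e , ≢-sym x≢y

    mates-irrefl : ∀ {x} → ¬ Mates x x
    mates-irrefl (_ , _ , _ , _ , x≢x) = x≢x refl

    mates⇒adj : ∀ {x y} → Mates x y → Adj x y
    mates⇒adj (_ , _ , x∈e , y∈e , x≢y) = ends-adjacent x∈e y∈e x≢y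

    mates-functional : ∀ {x y z} → Mates x y → Mates x z → y ≡ z
    mates-functional (e , e∈M , x∈e , y∈e , x≢y) (f , f∈M , x∈f , z∈f , x≢z) with e ≟ f
    ... | yes refl = other-end x∈e y∈e z∈f x≢y x≢z
    ... | no e≢f   = contradiction (_ , x∈e , x∈f) (matching e f e∈M f∈M e≢f)

    Matched : Fin n → Set
    Matched x = ∃[ e ] e ∈ M × Incident G x e

    matched? : ∀ x → Dec (Matched x)
    matched? x = any? λ e → (e ∈? M) ×-dec incident? G x e

    mates⇒matched : ∀ {x y} → Mates x y → Matched x
    mates⇒matched (e , e∈M , x∈e , _) = e , e∈M , x∈e

    mate : ∀ {x} → Matched x → ∃[ y ] Mates x y
    mate (e , e∈M , inj₁ refl) =
      target e , e , e∈M , inj₁ refl , inj₂ refl , adj⇒≢ (source~target e)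
    mate (e , e∈M , inj₂ refl) =
      source e , e , e∈M , inj₂ refl , inj₁ refl , ≢-sym (adj⇒≢ (source~target e))

    module _ (maximal : ¬ (∃[ M′ ] Matching G M′ × M ⊂ M′)) where

      -- The edge xy could otherwise be added to `M`.
      unmatched-independent : ∀ {x y} → ¬ Matched x → ¬ Matched y → ¬ Adj x y
      unmatched-independent {x} {y} ¬mx ¬my x~y
        with e , x∈e , y∈e , ends ← edge x~y =
        maximal (⁅ e ⁆ ∪ M , matching′ ,
          (λ f∈M → x∈p∪q⁺ (inj₂ f∈M)) , e , x∈p∪q⁺ (inj₁ (x∈⁅x⁆ e)) , λ e∈M → ¬mx (e , e∈M , x∈e))
        where
        disjoint : ∀ {f} → f ∈ M → Disjoint G e f
        disjoint f∈M (v , v∈e , v∈f) with ends v∈e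
        ... | inj₁ refl = ¬mx (_ , f∈M , v∈f)
        ... | inj₂ refl = ¬my (_ , f∈M , v∈f)

        matching′ : Matching G (⁅ e ⁆ ∪ M)
        matching′ f g f∈ g∈ f≢g with x∈p∪q⁻ ⁅ e ⁆ M f∈ | x∈p∪q⁻ ⁅ e ⁆ M g∈
        ... | inj₁ f∈e | inj₁ g∈e =
          contradiction (trans (x∈⁅y⁆⇒x≡y e f∈e) (sym (x∈⁅y⁆⇒x≡y e g∈e))) f≢g
        ... | inj₁ f∈e | inj₂ g∈M rewrite x∈⁅y⁆⇒x≡y e f∈e = disjoint g∈M
        ... | inj₂ f∈M | inj₁ g∈e rewrite x∈⁅y⁆⇒x≡y e g∈e =
          λ (v , v∈f , v∈e) → disjoint f∈M (v , v∈e , v∈f)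
        ... | inj₂ f∈M | inj₂ g∈M = matching f g f∈M g∈M f≢g

      -- Pairs of vertices opposite an unmatched vertex.

      module _ (cubic : Cubic G) where

        -- For these vertices the choice of ends matters: an unmatched vertex with two mated
        -- neighbours is adjacent to whichever end of their edge is chosen.
        Tight : Fin n → Set
        Tight u = ¬ Matched u × (∀ {x y} → Adj u x → Adj u y → ¬ Mates x y)

        -- The side facing a tight vertex in a triangle; choosing either of its ends dominates that
        -- vertex.
        Opposite : Rel (Fin n) 0ℓ
        Opposite x y = ∃[ u ] Tight u × Adj u x × Adj u y × Adj x y

        opposite-sym : Symmetric Opposite
        opposite-sym (u , tight , ux , uy , xy) = u , tight , uy , ux , symm xy

        opposite-irrefl : ∀ {x} → ¬ Opposite x x
        opposite-irrefl (_ , _ , _ , _ , xx) = irrefl refl xx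

        -- The neighbours of x are u, y and the mate of x.
        opposite-functional : ∀ {x y z} → Opposite x y → Opposite x z → y ≡ z
        opposite-functional {x} {y} {z} (u , (¬mu , tight) , ux , uy , xy)
                                        (v , (¬mv , tight′) , vx , vz , xz)
          with matched? x
        ... | no ¬mx = contradiction ux (unmatched-independent ¬mu ¬mx)
        ... | yes mx with p , x⟷p ← mate mx = conclude (neighbour (symm vx)) (neighbour xz)
          where
          mp : Matched p
          mp = mates⇒matched (mates-sym x⟷p)
          neighbour : ∀ {w} → Adj x w → w ≡ u ⊎ w ≡ y ⊎ w ≡ p
          neighbour = neighbour-cases cubic (symm ux) xy (mates⇒adj x⟷p) (adj⇒≢ uy)
            (λ { refl → ¬mu mp }) (λ { refl → tight ux uy x⟷p })
          -- If z is p, the tight vertex v sees both x and its mate. If z is u, then v is a loop at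
          -- u, an unmatched neighbour y of u, or the matched vertex p; each is impossible.
          conclude : v ≡ u ⊎ v ≡ y ⊎ v ≡ p → z ≡ u ⊎ z ≡ y ⊎ z ≡ p → y ≡ z
          conclude _                  (inj₂ (inj₁ z≡y))  = sym z≡y
          conclude _                  (inj₂ (inj₂ refl)) = contradiction x⟷p (tight′ vx vz)
          conclude (inj₁ refl)        (inj₁ refl)        = contradiction vz (irrefl refl)
          conclude (inj₂ (inj₁ refl)) (inj₁ _)           = contradiction uy (unmatched-independent ¬mu ¬mv)
          conclude (inj₂ (inj₂ refl)) (inj₁ _)           = contradiction mp ¬mv

        -- Choosing one end of every matching edge.

        module _
          {D : Pred (Fin n) 0ℓ} (D? : ∀ x → Dec (D x))
          (independent : ∀ {x y} → D x → D y → ¬ Mates x y)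
          (meets : ∀ {x y} → Opposite x y → D x ⊎ D y)
          where

          -- By independence an edge of `M` has at most one end in `D`, and then that end is chosen.
          -- If it has none, `target` is an arbitrary default.
          end : Edge G → Fin n
          end e with D? (source e)
          ... | yes _ = source e
          ... | no  _ = target e

          end-incident : ∀ e → Incident G (end e) e
          end-incident e with D? (source e)
          ... | yes _ = inj₁ refl
          ... | no  _ = inj₂ refl

          D⇒≡end : ∀ {x e} → e ∈ M → Incident G x e → D x → end e ≡ x
          D⇒≡end {e = e} e∈M x∈e Dx with D? (source e) | x∈e
          ... | yes _   | inj₁ refl = refl
          ... | yes Ds  | inj₂ refl = contradiction
            (e , e∈M , inj₁ refl , inj₂ refl , adj⇒≢ (source~target e)) (independent Ds Dx)
          ... | no ¬Ds  | inj₁ refl = contradiction Dx ¬Ds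
          ... | no _    | inj₂ refl = refl

          ends-dominate : ClawFree G → ∀ {E} → (∀ {e} → e ∈ M → end e ∈ E) → Dominating G E
          ends-dominate claw-free {E} end∈E v v∉E with matched? v
          ... | yes (e , e∈M , v∈e) = end e , end∈E e∈M ,
            ends-adjacent v∈e (end-incident e) λ v≡end → v∉E (subst (_∈ E) (sym v≡end) (end∈E e∈M))
          ... | no ¬mv with any? (λ x → any? λ y → adj? v x ×-dec (adj? v y ×-dec mates? x y))
          ...   | yes (x , y , vx , vy , e , e∈M , x∈e , y∈e , x≢y) = end e , end∈E e∈M , v~end
            where
            v~end : Adj v (end e)
            -- The chosen end is x or y, and both are adjacent to v.
            v~end with x ≟ end e
            ... | yes x≡end = subst (Adj v) x≡end vx
            ... | no  x≢end = subst (Adj v) (other-end x∈e y∈e (end-incident e) x≢y x≢end) vy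
          -- Here v is tight, so x or y lies in `D`. That vertex is matched, because v is not, and
          -- is therefore the chosen end of its edge.
          ...   | no ¬mates with x , y , vx , vy , xy ← adjacent-neighbours cubic claw-free v =
            [ dominated vx , dominated vy ]′
              (meets (v , (¬mv , λ va vb ab → ¬mates (_ , _ , va , vb , ab)) , vx , vy , xy))
            where
            dominated : ∀ {w} → Adj v w → D w → ∃[ u ] u ∈ E × Adj v u
            dominated {w} vw Dw with matched? w
            ... | no ¬mw = contradiction vw (unmatched-independent ¬mv ¬mw)
            ... | yes (e , e∈M , w∈e) = w , subst (_∈ E) (D⇒≡end e∈M w∈e Dw) (end∈E e∈M) , vw

theorem3 : ∀ {n : ℕ} (G : Graph n) → Cubic G → ClawFree G → γ G ≤ γₑ G
theorem3 {n} G cubic claw-free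
  with M , (matching , maximal) , _ ← minimumMaximalMatching G =
  -- The goal is a decidable inequality, so the transversal and a decision procedure for it may be
  -- used although both exist only up to double negation. `Mates` plays the role of `P` and
  -- `Opposite` that of `S`.
  decidable-stable (_ ℕ.≤? _) λ γ≰ →
  ¬¬-transversal (mates-sym G matching) (mates-irrefl G matching) (mates-functional G matching)
    (opposite-sym G matching maximal cubic) (opposite-irrefl G matching maximal cubic)
    (opposite-functional G matching maximal cubic) (allFin n)
    λ (D , independent , _ , meets) →
  ¬¬-decidable D λ D? →
  let meets′ = λ {x y} → meets (∈-allFin x) {y}
      E , ∣E∣≤∣M∣ , end∈E = image (end G matching maximal cubic D? independent meets′) M
      dominating = ends-dominate G matching maximal cubic D? independent meets′ claw-free end∈E
  in γ≰ (ℕ.≤-trans (proj₂ (proj₂ (minimumDominatingSet G)) E dominating) ∣E∣≤∣M∣)
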